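{- Let $G=(V,E)$ be a graph with $|V|\geq 3$ which is an $n$-convex geometry without stars, and let $x\in V$ be a quasi-star of $G$, that is, $d(x)=|V|-2$. Let $v(x)$ be the unique vertex in $V\setminus N[x]$. Then the vertex-deleted subgraph $G-\{x,v(x)\}$ (the subgraph of $G$ induced by $V\setminus\{x,v(x)\}$) is an $n$-convex geometry without stars.
   Context: All graphs are finite, simple and undirected, with non-empty vertex set. $d(x)$ denotes the degree of the vertex $x$. For a graph $G=(V,E)$ and $x\in V$, the closed neighbourhood of $x$ is $N[x]=\{x\}\cup\{y\in V:\{x,y\}\in E\}$. A star of $G$ is a vertex $s$ with $N[s]=V$. For $Y\subseteq V$, the common closed neighbourhood is $N[Y]=\bigcap_{y\in Y}N[y]$ if $Y\neq\varnothing$, and $N[\varnothing]=V$. The neighbourhood convexity of $G$ is the family $n_G=\{N[Y]:Y\subseteq V\}\cup\{\varnothing\}$ of subsets of $V$; it contains $\varnothing$ and $V$ and is closed under intersection. Its members are called $n$-convex sets. For $X\subseteq V$ the convex hull $[X]_{n}$ is the intersection of all $n$-convex sets containing $X$. For an $n$-convex set $K$, $\operatorname{ex}(K)=\{x\in K: K\setminus\{x\}\in n_G\}$ is the set of extreme points of $K$. $G$ is an $n$-convex geometry if $K=[\operatorname{ex}(K)]_{n}$ for every $n$-convex set $K$. A subgraph is an $n$-convex geometry if it is so with respect to its own neighbourhood convexity. -}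

module Defs where

open import Data.Fin.Base using (Fin)
open import Data.Fin.Subset
open import Data.Fin.Subset.Properties
  using (_∈?_; nonempty?; p─q⊆p; Empty-unique; ∣⊥∣≡0; ∣⁅x⁆∣≡1)
open import Data.List.Base using (allFin; filter; map)
open import Data.Nat.Base using (ℕ; suc; _+_; _≤_; z≤n; s≤s; s≤s⁻¹)
import Data.Nat.Properties as ℕ
open import Data.Product.Base using (∃-syntax; _×_; _,_)
open import Data.Sum.Base using (_⊎_)
open import Data.Vec.Base using ([]; _∷_; tabulate)
open import Level using (0ℓ)
open import Relation.Binary.Core using (Rel)
open import Relation.Binary.Definitions using (Decidable; Symmetric; Irreflexive)
open import Relation.Binary.PropositionalEquality
  using (_≡_; sym; subst)
open import Relation.Nullary.Decidable using (yes; no; does; _×-dec_)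
open import Relation.Nullary.Negation using (¬_; contradiction)
open import Relation.Unary using (Pred; _≐_)

-- The vertex set is an arbitrary non-empty subset of `Fin n`, so that an
-- induced subgraph keeps the names of its vertices.
record Graph (n : ℕ) : Set₁ where
  infix 4 _~_ _~?_
  field
    V          : Subset n
    V-nonempty : Nonempty V
    _~_        : Rel (Fin n) 0ℓ
    _~?_       : Decidable _~_
    ~-sym      : Symmetric _~_
    ~-irrefl   : Irreflexive _≡_ _~_
    ~⇒∈V       : ∀ {x y} → x ~ y → x ∈ V × y ∈ V

  order : ℕ
  order = ∣ V ∣

  neighbours : Fin n → Subset n
  neighbours x = tabulate (λ y → does (x ~? y))

  degree : Fin n → ℕ
  degree x = ∣ neighbours x ∣

  N[_] : Fin n → Subset n
  N[ x ] = ⁅ x ⁆ ∪ neighbours x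

  IsStar : Pred (Fin n) 0ℓ
  IsStar s = s ∈ V × N[ s ] ≡ V

  Starless : Set
  Starless = ∀ s → ¬ IsStar s

  -- d(x) = |V| - 2, written without truncated subtraction.
  IsQuasiStar : Pred (Fin n) 0ℓ
  IsQuasiStar x = x ∈ V × degree x + 2 ≡ order

  -- `⋂` of an empty list is all of `Fin n`, so intersecting with `V` gives
  -- `V` when `Y` is empty; it changes nothing when `∅ ≠ Y ⊆ V`.
  commonN : Subset n → Subset n
  commonN Y = V ∩ ⋂ (map N[_] (filter (_∈? Y) (allFin n)))

  Convex : Pred (Subset n) 0ℓ
  Convex K = (∃[ Y ] Y ⊆ V × K ≡ commonN Y) ⊎ K ≡ ⊥

  hull : Pred (Fin n) 0ℓ → Pred (Fin n) 0ℓ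
  hull X z = ∀ K → Convex K → (∀ {x} → X x → x ∈ K) → z ∈ K

  ex : Subset n → Pred (Fin n) 0ℓ
  ex K x = x ∈ K × Convex (K - x)

  IsConvexGeometry : Set
  IsConvexGeometry = ∀ K → Convex K → (_∈ K) ≐ hull (ex K)

open Graph

induced : ∀ {n} (G : Graph n) (S : Subset n) → S ⊆ V G → Nonempty S → Graph n
induced G S S⊆V S-nonempty = record
  { V          = S
  ; V-nonempty = S-nonempty
  ; _~_        = λ x y → x ∈ S × y ∈ S × _~_ G x y
  ; _~?_       = λ x y → (x ∈? S) ×-dec (y ∈? S) ×-dec (_~?_ G x y)
  ; ~-sym      = λ (x∈S , y∈S , x~y) → y∈S , x∈S , ~-sym G x~y
  ; ~-irrefl   = λ x≡y (_ , _ , x~y) → ~-irrefl G x≡y x~y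
  ; ~⇒∈V       = λ (x∈S , y∈S , _) → x∈S , y∈S
  }

∣p∣≤∣q∣+∣p─q∣ : ∀ {n} (p q : Subset n) → ∣ p ∣ ≤ ∣ q ∣ + ∣ p ─ q ∣
∣p∣≤∣q∣+∣p─q∣ []            []            = z≤n
∣p∣≤∣q∣+∣p─q∣ (inside  ∷ p) (inside  ∷ q) = s≤s (∣p∣≤∣q∣+∣p─q∣ p q)
∣p∣≤∣q∣+∣p─q∣ (outside ∷ p) (inside  ∷ q) = ℕ.m≤n⇒m≤1+n (∣p∣≤∣q∣+∣p─q∣ p q)
∣p∣≤∣q∣+∣p─q∣ (outside ∷ p) (outside ∷ q) = ∣p∣≤∣q∣+∣p─q∣ p q
∣p∣≤∣q∣+∣p─q∣ (inside  ∷ p) (outside ∷ q) =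
  subst (suc ∣ p ∣ ≤_) (sym (ℕ.+-suc ∣ q ∣ ∣ p ─ q ∣)) (s≤s (∣p∣≤∣q∣+∣p─q∣ p q))

∣p∣≤1+∣p-x∣ : ∀ {n} (p : Subset n) x → ∣ p ∣ ≤ 1 + ∣ p - x ∣
∣p∣≤1+∣p-x∣ p x =
  subst (λ k → ∣ p ∣ ≤ k + ∣ p - x ∣) (∣⁅x⁆∣≡1 x) (∣p∣≤∣q∣+∣p─q∣ p ⁅ x ⁆)

1≤∣p∣⇒nonempty : ∀ {n} (p : Subset n) → 1 ≤ ∣ p ∣ → Nonempty p
1≤∣p∣⇒nonempty {n} p 1≤∣p∣ with nonempty? p
... | yes ne = ne
... | no ¬ne =
  contradiction (subst (1 ≤_) (∣⊥∣≡0 n) (subst (λ q → 1 ≤ ∣ q ∣) (Empty-unique ¬ne) 1≤∣p∣)) λ ()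

3≤∣p∣⇒nonempty-p-x-y : ∀ {n} (p : Subset n) x y → 3 ≤ ∣ p ∣ → Nonempty (p - x - y)
3≤∣p∣⇒nonempty-p-x-y p x y 3≤∣p∣ = 1≤∣p∣⇒nonempty (p - x - y)
  (s≤s⁻¹ (ℕ.≤-trans (s≤s⁻¹ (ℕ.≤-trans 3≤∣p∣ (∣p∣≤1+∣p-x∣ p x))) (∣p∣≤1+∣p-x∣ (p - x) y)))

deletePair : ∀ {n} (G : Graph n) → 3 ≤ order G → Fin n → Fin n → Graph n
deletePair G 3≤∣V∣ x y = induced G (V G - x - y)
  (λ z∈ → p─q⊆p (V G) ⁅ x ⁆ (p─q⊆p (V G - x) ⁅ y ⁆ z∈))
  (3≤∣p∣⇒nonempty-p-x-y (V G) x y 3≤∣V∣)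

{-# OPTIONS --safe #-}

-- For a graph G order the vertices by z ≤ w iff N[w] ⊆ N[z].  A starless G is
-- an n-convex geometry iff it has no twins and each vertex y has an antipode:
-- a least non-neighbour of y.  Then the n-convex sets are the down-sets of ≤,
-- and the antipode map is an order-reversing involution.  The antipode of a
-- quasi-star x is v(x), so deleting {x, v(x)} deletes an orbit of this
-- involution, and both conditions survive.
module Submission where

open import Defs
open import Data.Fin.Base using (Fin)
open import Data.Fin.Properties using (_≟_; any?)
open import Data.Fin.Subset
open import Data.Fin.Subset.Induction using (Acc; acc; ⊂-wellFounded; ⊃-wellFounded)
open import Data.Fin.Subset.Properties
open import Data.List.Base using (List; []; _∷_; allFin; filter; map)
open import Data.List.Membership.Propositional.Properties using (∈-allFin; ∈-filter⁺; ∈-filter⁻)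
open import Data.List.Relation.Unary.All using (All; []; _∷_)
import Data.List.Relation.Unary.All as All
import Data.List.Relation.Unary.All.Properties as All
open import Data.Nat.Base using (ℕ; _+_; _≤_; _<_; s≤s)
import Data.Nat.Properties as ℕ
open import Data.Product.Base using (∃; _×_; _,_; proj₁; proj₂)
open import Data.Sum.Base using (_⊎_; inj₁; inj₂)
open import Data.Vec.Base using (_∷_; here; there)
open import Data.Vec.Properties using ([]=⇒lookup; lookup⇒[]=; lookup∘tabulate)
open import Relation.Binary.PropositionalEquality
  using (_≡_; _≢_; refl; sym; trans; subst)
open import Relation.Nullary.Decidable
  using (Dec; yes; no; ¬?; _×-dec_; dec-true; decidable-stable)
open import Relation.Nullary.Negation using (¬_; contradiction)

private
  variable
    n : ℕ

-- Subsets of a finite set.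

x∈p─q⇒x∉q : ∀ {x} (p q : Subset n) → x ∈ p ─ q → x ∉ q
x∈p─q⇒x∉q (inside ∷ p) (outside ∷ q) here ()
x∈p─q⇒x∉q (_ ∷ p) (_ ∷ q) (there x∈p─q) (there x∈q) = x∈p─q⇒x∉q p q x∈p─q x∈q

x∈p-y⇒x≢y : ∀ {x} (p : Subset n) y → x ∈ p - y → x ≢ y
x∈p-y⇒x≢y p y x∈p-y refl = x∈p─q⇒x∉q p ⁅ y ⁆ x∈p-y (x∈⁅x⁆ y)

⊈⇒∃ : {p q : Subset n} → ¬ p ⊆ q → ∃ λ x → x ∈ p × x ∉ q
⊈⇒∃ {p = p} {q} p⊈q with nonempty? (p ─ q)
... | yes (x , x∈p─q) = x , p─q⊆p p q x∈p─q , x∈p─q⇒x∉q p q x∈p─q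
... | no empty = contradiction
        (λ {x} x∈p → decidable-stable (x ∈? q) λ x∉q → empty (x , x∈p∧x∉q⇒x∈p─q x∈p x∉q))
        p⊈q

x∈⋂⁺ : ∀ {x} {ps : List (Subset n)} → All (x ∈_) ps → x ∈ ⋂ ps
x∈⋂⁺ []           = ∈⊤
x∈⋂⁺ (x∈p ∷ x∈ps) = x∈p∩q⁺ (x∈p , x∈⋂⁺ x∈ps)

x∈⋂⁻ : ∀ {x} (ps : List (Subset n)) → x ∈ ⋂ ps → All (x ∈_) ps
x∈⋂⁻ []       _    = []
x∈⋂⁻ (p ∷ ps) x∈⋂ with x∈p , x∈ps ← x∈p∩q⁻ p (⋂ ps) x∈⋂ = x∈p ∷ x∈⋂⁻ ps x∈ps

-- Closed neighbourhoods and convex sets.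

module _ (G : Graph n) where
  open Graph G

  ∈N⁺ : ∀ {y z} → z ≡ y ⊎ y ~ z → z ∈ N[ y ]
  ∈N⁺ {y}     (inj₁ refl) = x∈p∪q⁺ (inj₁ (x∈⁅x⁆ y))
  ∈N⁺ {y} {z} (inj₂ y~z)  = x∈p∪q⁺ (inj₂ (lookup⇒[]= z (neighbours y)
    (trans (lookup∘tabulate _ z) (dec-true (y ~? z) y~z))))

  ∈neighbours⁻ : ∀ {y z} → z ∈ neighbours y → y ~ z
  ∈neighbours⁻ {y} {z} z∈ with y ~? z | trans (sym (lookup∘tabulate _ z)) ([]=⇒lookup z∈)
  ... | yes y~z | _ = y~z
  ... | no _    | ()

  ∈N⁻ : ∀ {y z} → z ∈ N[ y ] → z ≡ y ⊎ y ~ z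
  ∈N⁻ {y} z∈ with x∈p∪q⁻ ⁅ y ⁆ (neighbours y) z∈
  ... | inj₁ z∈⁅y⁆ = inj₁ (x∈⁅y⁆⇒x≡y y z∈⁅y⁆)
  ... | inj₂ z∈nb  = inj₂ (∈neighbours⁻ z∈nb)

  x∈N[x] : ∀ {x} → x ∈ N[ x ]
  x∈N[x] = ∈N⁺ (inj₁ refl)

  N-sym : ∀ {y z} → z ∈ N[ y ] → y ∈ N[ z ]
  N-sym z∈N[y] with ∈N⁻ z∈N[y]
  ... | inj₁ z≡y = ∈N⁺ (inj₁ (sym z≡y))
  ... | inj₂ y~z = ∈N⁺ (inj₂ (~-sym y~z))

  N⊆V : ∀ {y} → y ∈ V → N[ y ] ⊆ V
  N⊆V y∈V z∈N[y] with ∈N⁻ z∈N[y]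
  ... | inj₁ refl = y∈V
  ... | inj₂ y~z  = proj₂ (~⇒∈V y~z)

  ∈commonN⁺ : ∀ {Y z} → z ∈ V → (∀ {u} → u ∈ Y → z ∈ N[ u ]) → z ∈ commonN Y
  ∈commonN⁺ {Y} z∈V z∈N = x∈p∩q⁺ (z∈V , x∈⋂⁺ (All.map⁺ (All.tabulate
    λ u∈ → z∈N (proj₂ (∈-filter⁻ (_∈? Y) {xs = allFin n} u∈)))))

  commonN⊆V : ∀ {Y} → commonN Y ⊆ V
  commonN⊆V z∈ = proj₁ (x∈p∩q⁻ V _ z∈)

  ∈commonN⁻ : ∀ {Y z} → z ∈ commonN Y → ∀ {u} → u ∈ Y → z ∈ N[ u ]
  ∈commonN⁻ {Y} z∈ {u} u∈Y = All.lookup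
    (All.map⁻ (x∈⋂⁻ (map N[_] (filter (_∈? Y) (allFin n))) (proj₂ (x∈p∩q⁻ V _ z∈))))
    (∈-filter⁺ (_∈? Y) (∈-allFin u) u∈Y)

  commonN-convex : ∀ {Y} → Y ⊆ V → Convex (commonN Y)
  commonN-convex {Y} Y⊆V = inj₁ (Y , Y⊆V , refl)

  convex⊆V : ∀ {K} → Convex K → K ⊆ V
  convex⊆V (inj₁ (_ , _ , refl)) = commonN⊆V
  convex⊆V (inj₂ refl)           = ⊥⊆

  N-convex : ∀ {y} → y ∈ V → Convex N[ y ]
  N-convex {y} y∈V = inj₁ (⁅ y ⁆ , ⁅y⁆⊆V , ⊆-antisym
    (λ z∈ → ∈commonN⁺ (N⊆V y∈V z∈) λ u∈ → subst (λ u → _ ∈ N[ u ]) (sym (x∈⁅y⁆⇒x≡y y u∈)) z∈)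
    (λ z∈ → ∈commonN⁻ z∈ (x∈⁅x⁆ y)))
    where
    ⁅y⁆⊆V : ⁅ y ⁆ ⊆ V
    ⁅y⁆⊆V u∈ = subst (_∈ V) (sym (x∈⁅y⁆⇒x≡y y u∈)) y∈V

  -- Twins and antipodes.

  TwinFree : Set
  TwinFree = ∀ {w z} → w ∈ V → z ∈ V → N[ w ] ⊆ N[ z ] → N[ z ] ⊆ N[ w ] → w ≡ z

  IsAntipode : Fin n → Fin n → Set
  IsAntipode y p = p ∈ V × p ∉ N[ y ] × (∀ {z} → z ∈ V → z ∉ N[ y ] → N[ z ] ⊆ N[ p ])

  HasAntipodes : Set
  HasAntipodes = ∀ {y} → y ∈ V → ∃ (IsAntipode y)

  -- If some `s` in `N[ z ]` were a non-neighbour of `y`, then `p` ≤ `s`, so `z`, being in `N[ s ]`,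
  -- would lie in `N[ p ]`.
  antipode-sym : ∀ {y p} → y ∈ V → IsAntipode y p → IsAntipode p y
  antipode-sym {y} {p} y∈V (p∈V , p∉N[y] , least) =
    y∈V , (λ y∈N[p] → p∉N[y] (N-sym y∈N[p])) , N[z]⊆N[y]
    where
    N[z]⊆N[y] : ∀ {z} → z ∈ V → z ∉ N[ p ] → N[ z ] ⊆ N[ y ]
    N[z]⊆N[y] z∈V z∉N[p] {s} s∈N[z] = decidable-stable (s ∈? N[ y ])
      λ s∉N[y] → z∉N[p] (least (N⊆V z∈V s∈N[z]) s∉N[y] (N-sym s∈N[z]))

  hasAntipodes⇒starless : HasAntipodes → Starless
  hasAntipodes⇒starless antipodes s (s∈V , N[s]≡V) with p , p∈V , p∉N[s] , _ ← antipodes s∈V =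
    p∉N[s] (subst (p ∈_) (sym N[s]≡V) p∈V)

  -- Starless convex geometries.

  module _ (starless : Starless) where

    -- With stars, K = ⊥ would be an exception.
    ∈-convex : ∀ {K z} → Convex K → z ∈ V →
               (∀ {u} → u ∈ V → K ⊆ N[ u ] → z ∈ N[ u ]) → z ∈ K
    ∈-convex (inj₁ (Y , Y⊆V , refl)) z∈V h =
      ∈commonN⁺ z∈V λ u∈Y → h (Y⊆V u∈Y) λ t∈K → ∈commonN⁻ t∈K u∈Y
    ∈-convex {z = z} (inj₂ refl) z∈V h = contradiction
      (z∈V , ⊆-antisym (N⊆V z∈V) λ u∈V → N-sym (h u∈V ⊥⊆))
      (starless z)

    module _ (geometry : IsConvexGeometry) where

      -- Anti-exchange over N[y]: the last two hypotheses say that a and b lie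
      -- in the same convex sets containing N[y].
      anti-exchange : ∀ {y a b} → y ∈ V → a ∈ V → b ∈ V → a ∉ N[ y ] → b ∉ N[ y ] →
        (∀ {u} → u ∈ V → N[ y ] ⊆ N[ u ] → a ∈ N[ u ] → b ∈ N[ u ]) →
        (∀ {u} → u ∈ V → N[ y ] ⊆ N[ u ] → b ∈ N[ u ] → a ∈ N[ u ]) →
        a ≡ b
      anti-exchange {y} {a} {b} y∈V a∈V b∈V a∉N[y] b∉N[y] a⇒b b⇒a =
        -- Otherwise all extreme points of `K` lie in the convex set `N[y]`, hence so does `K`,
        -- which contains `a`.
        decidable-stable (a ≟ b) λ a≢b →
          a∉N[y] (proj₁ (geometry K (commonN-convex D⊆V)) a∈K N[y] (N-convex y∈V) (ex⊆N[y] a≢b))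
        where
        N[y] D K : Subset n
        N[y] = N[ y ]
        -- `D` collects the `u` with `N[y]` and `a` inside `N[ u ]`, so `K` is the hull of `N[y]`
        -- together with `a`.
        D = commonN N[y] ∩ N[ a ]
        K = commonN D

        D⁻ : ∀ {u} → u ∈ D → u ∈ V × N[y] ⊆ N[ u ] × a ∈ N[ u ]
        D⁻ u∈D with u∈N , u∈N[a] ← x∈p∩q⁻ (commonN N[y]) N[ a ] u∈D =
          commonN⊆V u∈N , (λ t∈ → N-sym (∈commonN⁻ u∈N t∈)) , N-sym u∈N[a]

        D⁺ : ∀ {u} → u ∈ V → N[y] ⊆ N[ u ] → a ∈ N[ u ] → u ∈ D
        D⁺ u∈V N[y]⊆N[u] a∈N[u] =
          x∈p∩q⁺ (∈commonN⁺ u∈V (λ t∈ → N-sym (N[y]⊆N[u] t∈)) , N-sym a∈N[u])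

        D⊆V : D ⊆ V
        D⊆V u∈D = proj₁ (D⁻ u∈D)

        a∈K : a ∈ K
        a∈K = ∈commonN⁺ a∈V λ u∈D → proj₂ (proj₂ (D⁻ u∈D))

        b∈K : b ∈ K
        b∈K = ∈commonN⁺ b∈V λ u∈D → let u∈V , N[y]⊆ , a∈ = D⁻ u∈D in a⇒b u∈V N[y]⊆ a∈

        N[y]⊆K : N[y] ⊆ K
        N[y]⊆K t∈ = ∈commonN⁺ (N⊆V y∈V t∈) λ u∈D → proj₁ (proj₂ (D⁻ u∈D)) t∈

        -- The convex set `K - q` contains `N[y]` and `c`. If these forced `a`, every `N[ u ]`
        -- containing `K - q` would contain `K`, and `q` would lie in `K - q`.
        ex⊆[y,c] : ∀ {q c} → ex K q → q ∉ N[y] → c ∈ K → c ≢ q →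
          ¬ (∀ {u} → u ∈ V → N[y] ⊆ N[ u ] → c ∈ N[ u ] → a ∈ N[ u ])
        ex⊆[y,c] {q} {c} (q∈K , K-q-convex) q∉N[y] c∈K c≢q c⇒a =
          x∈p-y⇒x≢y K q (∈-convex K-q-convex (commonN⊆V q∈K) λ {u} u∈V K-q⊆N[u] →
            let N[y]⊆N[u] : N[y] ⊆ N[ u ]
                N[y]⊆N[u] t∈ = K-q⊆N[u] (x∈p∧x≢y⇒x∈p-y (N[y]⊆K t∈) λ { refl → q∉N[y] t∈ })
            in ∈commonN⁻ q∈K (D⁺ u∈V N[y]⊆N[u]
                 (c⇒a u∈V N[y]⊆N[u] (K-q⊆N[u] (x∈p∧x≢y⇒x∈p-y c∈K c≢q)))))
          refl

        ex⊆N[y] : a ≢ b → ∀ {q} → ex K q → q ∈ N[y]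
        ex⊆N[y] a≢b {q} q∈ex = decidable-stable (q ∈? N[y]) λ q∉N[y] → case-q q∉N[y] (a ≟ q)
          where
          case-q : q ∉ N[y] → ¬ Dec (a ≡ q)
          case-q q∉N[y] (no a≢q)   = ex⊆[y,c] q∈ex q∉N[y] a∈K a≢q λ _ _ a∈ → a∈
          case-q q∉N[y] (yes refl) = ex⊆[y,c] q∈ex q∉N[y] b∈K (λ b≡a → a≢b (sym b≡a)) b⇒a

      -- As `w` is no star, it has a non-neighbour `y`. Twins lie in the same sets `N[ u ]`, so
      -- anti-exchange over `N[ y ]` identifies them.
      twinFree : TwinFree
      twinFree {w} w∈V z∈V N[w]⊆N[z] N[z]⊆N[w]
        with y , y∈V , y∉N[w] ← ⊈⇒∃ (λ V⊆N[w] → starless w (w∈V , ⊆-antisym (N⊆V w∈V) V⊆N[w])) =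
        anti-exchange y∈V w∈V z∈V
          (λ w∈N[y] → y∉N[w] (N-sym w∈N[y]))
          (λ z∈N[y] → y∉N[w] (N[z]⊆N[w] (N-sym z∈N[y])))
          (λ _ _ w∈N[u] → N-sym (N[w]⊆N[z] (N-sym w∈N[u])))
          (λ _ _ z∈N[u] → N-sym (N[z]⊆N[w] (N-sym z∈N[u])))

      -- In terms of ≤, y is a minimal non-neighbour of p.
      Attached : Fin n → Fin n → Set
      Attached y p = p ∈ V × p ∉ N[ y ] ×
        (∀ {w} → w ∈ V → w ≢ y → N[ y ] ⊆ N[ w ] → p ∈ N[ w ])

      -- y is the extreme point of its own hull K, so K - y is convex, and a
      -- vertex separating y from K - y is attached to y.
      attached : ∀ {y} → y ∈ V → ∃ (Attached y)
      -- `commonN N[ y ]` is the down-set of `y`. The candidates lie in `N[ w ]` for each of its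
      -- elements `w` other than `y`, but not in `N[ y ]`.
      attached {y} y∈V with nonempty? (commonN (commonN N[ y ] - y) ─ N[ y ])
      ... | yes (p , p∈) = p
            , commonN⊆V p∈L
            , x∈p─q⇒x∉q L N[ y ] p∈
            , λ w∈V w≢y N[y]⊆N[w] → ∈commonN⁻ p∈L
                (x∈p∧x≢y⇒x∈p-y (∈commonN⁺ w∈V λ t∈ → N-sym (N[y]⊆N[w] t∈)) w≢y)
        where
        L = commonN (commonN N[ y ] - y)
        p∈L = p─q⊆p L N[ y ] p∈
      -- Without candidates `K` has no extreme points, so its hull of extreme points is empty
      -- although `y` is in `K`.
      ... | no empty = contradiction
              (proj₁ (geometry K (commonN-convex (N⊆V y∈V))) y∈K ⊥ (inj₂ refl)
                λ {q} q∈ex → contradiction q∈ex (ex-empty (q ≟ y)))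
              ∉⊥
        where
        K = commonN N[ y ]

        y∈K : y ∈ K
        y∈K = ∈commonN⁺ y∈V N-sym

        ex-empty : ∀ {q} → Dec (q ≡ y) → ¬ ex K q
        -- A set `N[ u ]` containing `K - y` but not `y` would make `u` a candidate.
        ex-empty (yes refl) (_ , K-y-convex) =
          x∈p-y⇒x≢y K y (∈-convex K-y-convex y∈V λ {u} u∈V K-y⊆N[u] →
            N-sym (decidable-stable (u ∈? N[ y ]) λ u∉N[y] →
              empty (u , x∈p∧x∉q⇒x∈p─q
                (∈commonN⁺ u∈V λ t∈ → N-sym (K-y⊆N[u] t∈)) u∉N[y])))
          refl
        ex-empty {q} (no q≢y) (q∈K , K-q-convex) =
          x∈p-y⇒x≢y K q (∈-convex K-q-convex (commonN⊆V q∈K) λ u∈V K-q⊆N[u] →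
            ∈commonN⁻ q∈K (N-sym (K-q⊆N[u] (x∈p∧x≢y⇒x∈p-y y∈K λ y≡q → q≢y (sym y≡q)))))
          refl

      -- Among the `N[ u ]` containing `N[ y ]`, those with `u` other than `y` contain both `p` and
      -- `q`, and `N[ y ]` contains neither.
      attached-unique : ∀ {y p q} → y ∈ V → Attached y p → Attached y q → p ≡ q
      attached-unique {y} y∈V (p∈V , p∉N[y] , p-below) (q∈V , q∉N[y] , q-below) =
        anti-exchange y∈V p∈V q∈V p∉N[y] q∉N[y]
          (λ u∈V N[y]⊆N[u] p∈N[u] → q-below u∈V (λ { refl → p∉N[y] p∈N[u] }) N[y]⊆N[u])
          (λ u∈V N[y]⊆N[u] q∈N[u] → p-below u∈V (λ { refl → q∉N[y] q∈N[u] }) N[y]⊆N[u])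

      -- If some w < p were not adjacent to y, then p and w would violate
      -- anti-exchange over N[y].
      attached-sym : ∀ {y p} → y ∈ V → Attached y p → Attached p y
      attached-sym {y} {p} y∈V (p∈V , p∉N[y] , p-below) =
        y∈V , (λ y∈N[p] → p∉N[y] (N-sym y∈N[p])) , λ {w} w∈V w≢p N[p]⊆N[w] →
          decidable-stable (y ∈? N[ w ]) λ y∉N[w] →
            let w∉N[y] : w ∉ N[ y ]
                w∉N[y] w∈N[y] = y∉N[w] (N-sym w∈N[y])
            in w≢p (sym (anti-exchange y∈V p∈V w∈V p∉N[y] w∉N[y]
                 (λ _ _ p∈N[u] → N-sym (N[p]⊆N[w] (N-sym p∈N[u])))
                 (λ u∈V N[y]⊆N[u] w∈N[u] →
                   p-below u∈V (λ { refl → w∉N[y] w∈N[u] }) N[y]⊆N[u])))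

      -- Descend from z to a minimal non-neighbour of p; it is attached to p,
      -- hence equal to y.
      attached⇒antipode : ∀ {p y} → p ∈ V → Attached p y → IsAntipode p y
      attached⇒antipode {p} {y} p∈V att@(y∈V , y∉N[p] , _) =
        y∈V , y∉N[p] , λ z∈V z∉N[p] →
          N[z]⊆N[y] (⊃-wellFounded _) z∈V λ p∈N[z] → z∉N[p] (N-sym p∈N[z])
        where
        N[z]⊆N[y] : ∀ {z} → Acc _⊃_ N[ z ] → z ∈ V → p ∉ N[ z ] → N[ z ] ⊆ N[ y ]
        N[z]⊆N[y] {z} (acc rec) z∈V p∉N[z]
          with any? (λ w → w ∈? V ×-dec ¬? (w ≟ z) ×-dec N[ z ] ⊆? N[ w ] ×-dec ¬? (p ∈? N[ w ]))
        ... | no none = subst (λ q → _ ∈ N[ q ])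
                (attached-unique p∈V (attached-sym z∈V (p∈V , p∉N[z] , p-below)) att)
          where
          p-below : ∀ {w} → w ∈ V → w ≢ z → N[ z ] ⊆ N[ w ] → p ∈ N[ w ]
          p-below {w} w∈V w≢z N[z]⊆N[w] = decidable-stable (p ∈? N[ w ])
            λ p∉N[w] → none (w , w∈V , w≢z , N[z]⊆N[w] , p∉N[w])
        ... | yes (w , w∈V , w≢z , N[z]⊆N[w] , p∉N[w]) = λ t∈ →
                N[z]⊆N[y] (rec (N[z]⊆N[w] , strict)) w∈V p∉N[w] (N[z]⊆N[w] t∈)
          where
          -- Going down in ≤ enlarges neighbourhoods, strictly so in the absence of twins.
          strict : ∃ λ t → t ∈ N[ w ] × t ∉ N[ z ]
          strict = ⊈⇒∃ λ N[w]⊆N[z] → w≢z (twinFree w∈V z∈V N[w]⊆N[z] N[z]⊆N[w])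

      hasAntipodes : HasAntipodes
      hasAntipodes y∈V with p , att ← attached y∈V = p , attached⇒antipode y∈V att

  -- Convex geometries from antipodes.

  module _ (twin-free : TwinFree) (antipodes : HasAntipodes) where

    DownClosed : Subset n → Set
    DownClosed K = ∀ {w z} → w ∈ K → z ∈ V → N[ w ] ⊆ N[ z ] → z ∈ K

    convex⇒downClosed : ∀ {K} → Convex K → DownClosed K
    convex⇒downClosed (inj₁ (Y , Y⊆V , refl)) w∈K z∈V N[w]⊆N[z] =
      ∈commonN⁺ z∈V λ u∈Y → N-sym (N[w]⊆N[z] (N-sym (∈commonN⁻ w∈K u∈Y)))
    convex⇒downClosed (inj₂ refl) w∈⊥ = contradiction w∈⊥ ∉⊥

    -- If `z` is outside `K` and has antipode `p`, then `N[ p ]` separates `z` from `K`: a `u` in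
    -- `K` outside `N[ p ]` would satisfy `z` ≤ `u`, as `z` is the antipode of `p`, and put `z` into
    -- `K`.
    downClosed⇒convex : ∀ {K} → K ⊆ V → DownClosed K → Convex K
    downClosed⇒convex {K} K⊆V down = inj₁ (commonN K , commonN⊆V , ⊆-antisym
      (λ z∈K → ∈commonN⁺ (K⊆V z∈K) λ u∈ → N-sym (∈commonN⁻ u∈ z∈K))
      (λ {z} z∈ → decidable-stable (z ∈? K) (∉K⇒∉hull z∈)))
      where
      ∉K⇒∉hull : ∀ {z} → z ∈ commonN (commonN K) → ¬ z ∉ K
      ∉K⇒∉hull {z} z∈ z∉K with p , p-antipode@(p∈V , p∉N[z] , _) ← antipodes (commonN⊆V z∈) =
        p∉N[z] (N-sym (∈commonN⁻ z∈ (∈commonN⁺ p∈V λ {u} u∈K →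
          decidable-stable (p ∈? N[ u ]) λ p∉N[u] →
            z∉K (down u∈K (commonN⊆V z∈)
              (proj₂ (proj₂ (antipode-sym (commonN⊆V z∈) p-antipode))
                (K⊆V u∈K) λ u∈N[p] → p∉N[u] (N-sym u∈N[p]))))))

    -- The extreme points of a down-set are its maximal elements, and every
    -- element lies below one of these.
    isConvexGeometry : IsConvexGeometry
    isConvexGeometry K K-convex =
      (λ z∈K C C-convex ex⊆C → below-ex C-convex ex⊆C (⊂-wellFounded _) z∈K) ,
      (λ z∈hull → z∈hull K K-convex proj₁)
      where
      K⊆V : K ⊆ V
      K⊆V = convex⊆V K-convex

      below-ex : ∀ {C z} → Convex C → (∀ {q} → ex K q → q ∈ C) → Acc _⊂_ N[ z ] → z ∈ K → z ∈ C
      below-ex {C} {z} C-convex ex⊆C (acc rec) z∈K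
        with any? (λ w → w ∈? K ×-dec ¬? (w ≟ z) ×-dec N[ w ] ⊆? N[ z ])
      ... | no none = ex⊆C (z∈K , downClosed⇒convex (λ t∈ → K⊆V (p─q⊆p K ⁅ z ⁆ t∈))
              λ {w} {t} w∈K-z t∈V N[w]⊆N[t] →
                let w∈K = p─q⊆p K ⁅ z ⁆ w∈K-z
                in x∈p∧x≢y⇒x∈p-y (convex⇒downClosed K-convex w∈K t∈V N[w]⊆N[t])
                     λ { refl → none (w , w∈K , x∈p-y⇒x≢y K z w∈K-z , N[w]⊆N[t]) })
      ... | yes (w , w∈K , w≢z , N[w]⊆N[z]) = convex⇒downClosed C-convex
              (below-ex C-convex ex⊆C (rec (N[w]⊆N[z] , strict)) w∈K) (K⊆V z∈K) N[w]⊆N[z]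
        where
        strict : ∃ λ t → t ∈ N[ z ] × t ∉ N[ w ]
        strict = ⊈⇒∃ λ N[z]⊆N[w] → w≢z (twin-free (K⊆V w∈K) (K⊆V z∈K) N[w]⊆N[z] N[z]⊆N[w])

  -- Quasi-stars.

  quasiStar-unique : ∀ {x v u} → IsQuasiStar x → v ∈ V → v ∉ N[ x ] → u ∈ V → u ∉ N[ x ] → u ≡ v
  quasiStar-unique {x} {v} {u} (x∈V , d+2≡∣V∣) v∈V v∉N[x] u∈V u∉N[x] =
    -- Otherwise the neighbours of `x` avoid three distinct vertices `x`, `v`, `u`, so `x` has
    -- degree at most |V| - 3.
    decidable-stable (u ≟ v) λ u≢v → ℕ.<⇒≱ (∣V-x-v-u∣+2<∣V∣ u≢v) (begin
      order                   ≡⟨ d+2≡∣V∣ ⟨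
      degree x + 2            ≤⟨ ℕ.+-monoˡ-≤ 2 (p⊆q⇒∣p∣≤∣q∣ nb⊆V-x-v-u) ⟩
      ∣ V - x - v - u ∣ + 2   ≡⟨ ℕ.+-comm _ 2 ⟩
      2 + ∣ V - x - v - u ∣   ∎)
    where
    open ℕ.≤-Reasoning

    ≢x : ∀ {t} → t ∉ N[ x ] → t ≢ x
    ≢x t∉N[x] t≡x = t∉N[x] (∈N⁺ (inj₁ t≡x))

    ∣V-x-v-u∣+2<∣V∣ : u ≢ v → 2 + ∣ V - x - v - u ∣ < order
    ∣V-x-v-u∣+2<∣V∣ u≢v = ℕ.<-≤-trans
      (s≤s (s≤s (x∈p⇒∣p-x∣<∣p∣ (x∈p∧x≢y⇒x∈p-y (x∈p∧x≢y⇒x∈p-y u∈V (≢x u∉N[x])) u≢v))))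
      (ℕ.≤-trans (s≤s (x∈p⇒∣p-x∣<∣p∣ (x∈p∧x≢y⇒x∈p-y v∈V (≢x v∉N[x])))) (x∈p⇒∣p-x∣<∣p∣ x∈V))

    nb⊆V-x-v-u : neighbours x ⊆ V - x - v - u
    nb⊆V-x-v-u t∈nb with x~t ← ∈neighbours⁻ t∈nb =
      x∈p∧x≢y⇒x∈p-y (x∈p∧x≢y⇒x∈p-y (x∈p∧x≢y⇒x∈p-y (proj₂ (~⇒∈V x~t))
        (λ t≡x → ~-irrefl (sym t≡x) x~t))
        (λ { refl → v∉N[x] (∈N⁺ (inj₂ x~t)) }))
        (λ { refl → u∉N[x] (∈N⁺ (inj₂ x~t)) })

-- Induced subgraphs closed under antipodes.

module _ (G : Graph n) {S : Subset n} (S⊆V : S ⊆ Graph.V G) (S-nonempty : Nonempty S) where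
  open Graph G

  private
    H : Graph n
    H = induced G S S⊆V S-nonempty

  ∈N-induced⁺ : ∀ {y z} → y ∈ S → z ∈ S → z ∈ N[ y ] → z ∈ Graph.N[_] H y
  ∈N-induced⁺ y∈S z∈S z∈N[y] with ∈N⁻ G z∈N[y]
  ... | inj₁ z≡y = ∈N⁺ H (inj₁ z≡y)
  ... | inj₂ y~z = ∈N⁺ H (inj₂ (y∈S , z∈S , y~z))

  ∈N-induced⁻ : ∀ {y z} → z ∈ Graph.N[_] H y → z ∈ N[ y ]
  ∈N-induced⁻ z∈N[y] with ∈N⁻ H z∈N[y]
  ... | inj₁ z≡y           = ∈N⁺ G (inj₁ z≡y)
  ... | inj₂ (_ , _ , y~z) = ∈N⁺ G (inj₂ y~z)

  module _ (antipodes : ∀ {y} → y ∈ S → ∃ λ p → p ∈ S × IsAntipode G y p) where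

    -- Neighbourhoods in `H` are the traces on `S` of those in `G`, so the antipodes of `G` still
    -- serve.
    induced-hasAntipodes : HasAntipodes H
    induced-hasAntipodes y∈S with p , p∈S , _ , p∉N[y] , least ← antipodes y∈S =
      p , p∈S , (λ p∈N[y] → p∉N[y] (∈N-induced⁻ p∈N[y])) ,
      λ z∈S z∉N[y] t∈N[z] → ∈N-induced⁺ p∈S (N⊆V H z∈S t∈N[z])
        (least (S⊆V z∈S) (λ z∈N[y] → z∉N[y] (∈N-induced⁺ y∈S z∈S z∈N[y])) (∈N-induced⁻ t∈N[z]))

    -- N[w] ⊆ N[z] holds as soon as the antipode of z is not adjacent to w,
    -- and this can be read off inside S.
    induced-twinFree : TwinFree G → TwinFree H
    induced-twinFree twin-free w∈S z∈S N[w]⊆N[z] N[z]⊆N[w] =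
      twin-free (S⊆V w∈S) (S⊆V z∈S) (lift w∈S z∈S N[w]⊆N[z]) (lift z∈S w∈S N[z]⊆N[w])
      where
      lift : ∀ {w z} → w ∈ S → z ∈ S → Graph.N[_] H w ⊆ Graph.N[_] H z → N[ w ] ⊆ N[ z ]
      lift {w} w∈S z∈S N[w]⊆N[z] with p , p∈S , p-antipode@(_ , p∉N[z] , _) ← antipodes z∈S =
        proj₂ (proj₂ (antipode-sym G (S⊆V z∈S) p-antipode)) (S⊆V w∈S) λ w∈N[p] →
          p∉N[z] (∈N-induced⁻ (N[w]⊆N[z] (∈N-induced⁺ w∈S p∈S (N-sym G w∈N[p]))))

-- Deleting a quasi-star and its antipode.

module _ (G : Graph n) (twin-free : TwinFree G) (antipodes : HasAntipodes G) where
  open Graph G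

  -- If `x` were the antipode of `y`, then `y` would be a non-neighbour of `x`, hence `v`. If `v`
  -- were, then `y` would be a twin of `x`.
  antipode-deletePair : ∀ {x v} → x ∈ V → v ∈ V → v ∉ N[ x ] →
    (∀ {u} → u ∈ V → u ∉ N[ x ] → u ≡ v) →
    ∀ {y} → y ∈ V - x - v → ∃ λ p → p ∈ V - x - v × IsAntipode G y p
  antipode-deletePair {x} {v} x∈V v∈V v∉N[x] unique {y} y∈V-x-v
    with p , p-antipode@(p∈V , p∉N[y] , _) ← antipodes (p─q⊆p V ⁅ x ⁆ (p─q⊆p (V - x) ⁅ v ⁆ y∈V-x-v)) =
      p , x∈p∧x≢y⇒x∈p-y (x∈p∧x≢y⇒x∈p-y p∈V p≢x) p≢v , p-antipode
    where
    y∈V-x : y ∈ V - x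
    y∈V-x = p─q⊆p (V - x) ⁅ v ⁆ y∈V-x-v

    y∈V : y ∈ V
    y∈V = p─q⊆p V ⁅ x ⁆ y∈V-x

    p≢x : p ≢ x
    p≢x refl = x∈p-y⇒x≢y (V - x) v y∈V-x-v (unique y∈V λ y∈N[x] → p∉N[y] (N-sym G y∈N[x]))

    p≢v : p ≢ v
    -- `N[ y ]` misses `v`, the only vertex outside `N[ x ]`. Conversely `y` is the antipode of `v`
    -- and `x` a non-neighbour of `v`, so `y` ≤ `x`.
    p≢v refl = x∈p-y⇒x≢y V x y∈V-x (twin-free y∈V x∈V
      (λ {t} t∈N[y] → decidable-stable (t ∈? N[ x ]) λ t∉N[x] →
        p∉N[y] (subst (_∈ N[ y ]) (unique (N⊆V G y∈V t∈N[y]) t∉N[x]) t∈N[y]))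
      (proj₂ (proj₂ (antipode-sym G y∈V p-antipode)) x∈V λ x∈N[v] → v∉N[x] (N-sym G x∈N[v])))

open Graph

theorem33 : ∀ {n : ℕ} (G : Graph n) (3≤∣V∣ : 3 ≤ order G)
    → IsConvexGeometry G
    → Starless G
    → (x : Fin n) → IsQuasiStar G x
    → (v : Fin n) → v ∈ V G ─ N[_] G x
    → IsConvexGeometry (deletePair G 3≤∣V∣ x v)
    × Starless (deletePair G 3≤∣V∣ x v)
theorem33 G 3≤∣V∣ geometry starless x x-quasiStar v v∈V─N[x] =
  isConvexGeometry H (induced-twinFree G S⊆V S-nonempty antipodes (twinFree G starless geometry))
    antipodes-H ,
  hasAntipodes⇒starless H antipodes-H
  where
  H = deletePair G 3≤∣V∣ x v

  S⊆V : V H ⊆ V G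
  S⊆V z∈ = p─q⊆p (V G) ⁅ x ⁆ (p─q⊆p (V G - x) ⁅ v ⁆ z∈)

  S-nonempty = 3≤∣p∣⇒nonempty-p-x-y (V G) x v 3≤∣V∣

  v∈V = p─q⊆p (V G) (N[_] G x) v∈V─N[x]
  v∉N[x] = x∈p─q⇒x∉q (V G) (N[_] G x) v∈V─N[x]

  antipodes : ∀ {y} → y ∈ V H → ∃ λ p → p ∈ V H × IsAntipode G y p
  antipodes = antipode-deletePair G (twinFree G starless geometry) (hasAntipodes G starless geometry)
    (proj₁ x-quasiStar) v∈V v∉N[x] (quasiStar-unique G x-quasiStar v∈V v∉N[x])

  antipodes-H : HasAntipodes H
  antipodes-H = induced-hasAntipodes G S⊆V S-nonempty antipodes
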